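{- Let $k \geq 1$ be an integer. For any two graphs $G_1, G_2$: (i) $\alpha_k(G_1 \square G_2) \geq \alpha_k(G_1) \cdot \alpha_k(G_2)$; (ii) $\alpha_k(G_1 \square G_2) \leq \min\left(\alpha_k(G_1) \cdot |V(G_2)|,\ \alpha_k(G_2) \cdot |V(G_1)|\right)$.
   Context: Graphs are finite, simple and undirected. For a graph $G$, $\delta_G(u,v)$ is the length of a shortest path between vertices $u$ and $v$ in $G$ (equal to $\infty$ if there is none). A set $S \subseteq V(G)$ is $k$-independent if $\delta_G(u,v) > k$ for all distinct $u,v \in S$; $\alpha_k(G)$ denotes the maximum size of a $k$-independent set in $G$. The Cartesian product $G_1 \square G_2$ has vertex set $V(G_1)\times V(G_2)$, and $(u_1,u_2),(v_1,v_2)$ are adjacent if and only if ($u_1=v_1$ and $(u_2,v_2)\in E(G_2)$) or ($u_2=v_2$ and $(u_1,v_1)\in E(G_1)$). -}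

module Defs where

open import Data.Fin.Base using (Fin; zero; suc)
import Data.Fin.Properties as Fin
open import Data.List.Base as List using (List; []; _∷_; length)
open import Data.List.Membership.Propositional using (_∈_)
open import Data.List.Membership.Propositional.Properties using (∈-lookup)
import Data.List.Membership.DecPropositional as DecMembership
import Data.List.Relation.Unary.All as ListAll
import Data.List.Relation.Unary.Unique.DecPropositional as DecUnique
open import Data.List.Relation.Unary.AllPairs using ([]; _∷_)
open import Data.List.Relation.Unary.Unique.Propositional as ListUnique using ()
open import Data.Nat.Base using (ℕ; zero; suc; _*_; _≤_; _<_; s≤s; s≤s⁻¹; s<s⁻¹; z≤n)
open import Data.Nat.Properties using (_<?_; m≤n⇒m<n∨m≡n; suc-injective)
open import Data.Product.Base using (∃; ∃-syntax; _×_; _,_; proj₁)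
open import Data.Product.Function.NonDependent.Propositional using (_×-↔_)
open import Data.Sum.Base using (_⊎_; inj₁; inj₂) renaming (map to ⊎-map)
open import Data.Vec.Base using (Vec; []; _∷_; head; last)
import Data.Vec.Relation.Unary.AllPairs as VecAllPairs
open import Data.Vec.Relation.Unary.Linked using (Linked; linked?)
open import Data.Vec.Relation.Unary.Unique.Propositional using (Unique)
open import Data.Vec.Relation.Unary.Unique.Propositional.Properties using (lookup-injective)
open import Function.Base using (_∘_)
open import Function.Bundles using (_↔_; Inverse; Injection)
open import Function.Construct.Composition using (_↔-∘_)
open import Function.Construct.Symmetry using (↔-sym)
open import Function.Properties.Inverse using (↔⇒↣)
open import Level using (0ℓ)
open import Relation.Binary.Core using (Rel)
open import Relation.Binary.Construct.Add.Supremum.Strict _<_ using (_<⁺_; <⁺-dec)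
open import Relation.Binary.Definitions using (Decidable; DecidableEquality; Irreflexive; Symmetric)
open import Relation.Binary.PropositionalEquality using (_≡_; _≢_; refl; sym; cong; subst)
open import Relation.Nullary.Construct.Add.Supremum using (_⁺; [_]; ⊤⁺)
open import Relation.Nullary.Decidable using (Dec; yes; no; map′; ¬?; _×-dec_; _⊎-dec_; _→-dec_; via-injection)
open import Relation.Nullary.Negation using (¬_; contradiction)
import Relation.Unary as U

-- The vertex set is a type in bijection with some Fin order, so that a product
-- of graphs can have an actual product of types as its vertex set.  Decidability
-- of adjacency is what it constructively means for the edge set to be finite.
record Graph : Set₁ where
  infix 4 _~_ _~?_
  field
    Vertex : Set
    order  : ℕ
    enum   : Vertex ↔ Fin order
    _~_    : Rel Vertex 0ℓ
    _~?_   : Decidable _~_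
    ~-sym  : Symmetric _~_
    ~-irr  : Irreflexive _≡_ _~_

  _≟_ : DecidableEquality Vertex
  _≟_ = via-injection (↔⇒↣ enum) Fin._≟_

  anyVertex? : {P : U.Pred Vertex 0ℓ} → U.Decidable P → Dec (∃ P)
  anyVertex? {P} P? = map′
    (λ (i , p) → from i , p)
    (λ (v , p) → to v , subst P (sym (strictlyInverseʳ v)) p)
    (Fin.any? (P? ∘ from))
    where open Inverse enum

  allVertices? : {P : U.Pred Vertex 0ℓ} → U.Decidable P → Dec (∀ v → P v)
  allVertices? {P} P? = map′
    (λ f v → subst P (strictlyInverseʳ v) (f (to v)))
    (λ f i → f (from i))
    (Fin.all? (P? ∘ from))
    where open Inverse enum

open Graph using (Vertex; order)

infixr 7 _□_

_□_ : Graph → Graph → Graph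
G₁ □ G₂ = record
  { Vertex = G₁.Vertex × G₂.Vertex
  ; order  = G₁.order * G₂.order
  ; enum   = ↔-sym Fin.*↔× ↔-∘ (G₁.enum ×-↔ G₂.enum)
  ; _~_    = λ (u₁ , u₂) (v₁ , v₂) → (u₁ ≡ v₁ × u₂ G₂.~ v₂) ⊎ (u₂ ≡ v₂ × u₁ G₁.~ v₁)
  ; _~?_   = λ (u₁ , u₂) (v₁ , v₂) →
      ((u₁ G₁.≟ v₁) ×-dec (u₂ G₂.~? v₂)) ⊎-dec ((u₂ G₂.≟ v₂) ×-dec (u₁ G₁.~? v₁))
  ; ~-sym  = ⊎-map (λ (e , a) → sym e , G₂.~-sym a) (λ (e , a) → sym e , G₁.~-sym a)
  ; ~-irr  = λ { refl (inj₁ (_ , a)) → G₂.~-irr refl a ; refl (inj₂ (_ , a)) → G₁.~-irr refl a }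
  }
  where
  module G₁ = Graph G₁
  module G₂ = Graph G₂

-- A path with m edges has m + 1 distinct vertices; m is its length.
record Path (G : Graph) (u v : Vertex G) (m : ℕ) : Set where
  open Graph G using (_~_)
  field
    vertices : Vec (Vertex G) (suc m)
    starts   : head vertices ≡ u
    ends     : last vertices ≡ v
    linked   : Linked _~_ vertices
    unique   : Unique vertices

ℕ∞ : Set
ℕ∞ = ℕ ⁺

IsDistance : (G : Graph) → Vertex G → Vertex G → ℕ∞ → Set
IsDistance G u v [ d ] = Path G u v d × (∀ {m} → Path G u v m → d ≤ m)
IsDistance G u v ⊤⁺    = ∀ {m} → ¬ Path G u v m

private
  Exhaustible : Set → Set₁
  Exhaustible A = {P : U.Pred A 0ℓ} → U.Decidable P → Dec (∃ P)

  anyVec? : {A : Set} → Exhaustible A → (n : ℕ) → Exhaustible (Vec A n)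
  anyVec? any? zero    P? = map′ ([] ,_) (λ { ([] , p) → p }) (P? [])
  anyVec? any? (suc n) P? = map′
    (λ (x , xs , p) → x ∷ xs , p)
    (λ { (x ∷ xs , p) → x , xs , p })
    (any? λ x → anyVec? any? n λ xs → P? (x ∷ xs))

  anyList? : {A : Set} → Exhaustible A → {P : U.Pred (List A) 0ℓ} → U.Decidable P →
             ∀ n → Dec (∃[ xs ] length xs ≡ n × P xs)
  anyList? any? P? zero    = map′ (λ p → [] , refl , p) (λ { ([] , _ , p) → p }) (P? [])
  anyList? any? P? (suc n) = map′
    (λ (x , xs , e , p) → x ∷ xs , cong suc e , p)
    (λ { (x ∷ xs , e , p) → x , xs , suc-injective e , p })
    (any? λ x → anyList? any? (λ xs → P? (x ∷ xs)) n)

  least : {P : U.Pred ℕ 0ℓ} → U.Decidable P → ∀ b → (∀ {m} → P m → m < b) →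
          (∃[ d ] P d × (∀ {m} → P m → d ≤ m)) ⊎ (∀ {m} → ¬ P m)
  least P? zero    bounded = inj₂ (λ p → contradiction (bounded p) λ ())
  least P? (suc b) bounded with P? 0
  ... | yes p = inj₁ (0 , p , λ _ → z≤n)
  ... | no ¬p with least (P? ∘ suc) b (λ p → s<s⁻¹ (bounded p))
  ...   | inj₁ (d , p , min) = inj₁ (suc d , p , λ { {zero} q → contradiction q ¬p ; {suc _} q → s≤s (min q) })
  ...   | inj₂ none          = inj₂ λ { {zero} q → ¬p q ; {suc _} q → none q }

  greatest : {P : U.Pred ℕ 0ℓ} → U.Decidable P → P 0 → ∀ b → (∀ {m} → P m → m ≤ b) →
             ∃[ a ] P a × (∀ {m} → P m → m ≤ a)
  greatest P? p₀ zero    bounded = 0 , p₀ , bounded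
  greatest P? p₀ (suc b) bounded with P? (suc b)
  ... | yes p = suc b , p , bounded
  ... | no ¬p = greatest P? p₀ b below
    where
    below : ∀ {m} → _ → m ≤ b
    below q with m≤n⇒m<n∨m≡n (bounded q)
    ... | inj₁ m<1+b = s≤s⁻¹ m<1+b
    ... | inj₂ refl  = contradiction q ¬p

  listLookup-injective : {A : Set} {xs : List A} → ListUnique.Unique xs →
                         ∀ i j → List.lookup xs i ≡ List.lookup xs j → i ≡ j
  listLookup-injective (_  ∷ _) zero    zero    _ = refl
  listLookup-injective (x∉ ∷ _) zero    (suc j) e = contradiction e (ListAll.lookup x∉ (∈-lookup j))
  listLookup-injective (x∉ ∷ _) (suc i) zero    e = contradiction (sym e) (ListAll.lookup x∉ (∈-lookup i))
  listLookup-injective (_  ∷ u) (suc i) (suc j) e = cong suc (listLookup-injective u i j e)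

module _ (G : Graph) where
  open Graph G using (enum; _~?_; _≟_; anyVertex?; allVertices?)

  private
    enum-injective : ∀ {u v} → Inverse.to enum u ≡ Inverse.to enum v → u ≡ v
    enum-injective = Injection.injective (↔⇒↣ enum)

  path? : ∀ u v m → Dec (Path G u v m)
  path? u v m = map′
    (λ (p , s , e , l , d) → record { vertices = p ; starts = s ; ends = e ; linked = l ; unique = d })
    (λ p → let open Path p in vertices , starts , ends , linked , unique)
    (anyVec? anyVertex? (suc m) λ p →
      (head p ≟ u) ×-dec (last p ≟ v) ×-dec linked? _~?_ p
        ×-dec VecAllPairs.allPairs? (λ x y → ¬? (x ≟ y)) p)

  path-bounded : ∀ {u v m} → Path G u v m → m < order G
  path-bounded p = Fin.injective⇒≤ λ e → lookup-injective (Path.unique p) _ _ (enum-injective e)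

  distance : ∀ u v → ∃ (IsDistance G u v)
  distance u v with least (path? u v) (order G) path-bounded
  ... | inj₁ (d , isLeast) = [ d ] , isLeast
  ... | inj₂ none          = ⊤⁺ , none

  δ : Vertex G → Vertex G → ℕ∞
  δ u v = proj₁ (distance u v)

  Independent : ℕ → List (Vertex G) → Set
  Independent k S = ∀ {u v} → u ∈ S → v ∈ S → u ≢ v → [ k ] <⁺ δ u v

  -- A finite set of vertices is represented by a duplicate-free list of its
  -- elements, whose length is then its cardinality.
  IndependentOfSize : ℕ → ℕ → Set
  IndependentOfSize k m = ∃[ S ] length S ≡ m × ListUnique.Unique S × Independent k S

  IsIndependenceNumber : ℕ → ℕ → Set
  IsIndependenceNumber k a = IndependentOfSize k a × (∀ {m} → IndependentOfSize k m → m ≤ a)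

  independent? : ∀ k S → Dec (Independent k S)
  independent? k S = map′ (λ f {u} {v} → f u v) (λ f u v → f {u} {v})
    (allVertices? λ u → allVertices? λ v →
      (u ∈? S) →-dec (v ∈? S) →-dec ¬? (u ≟ v) →-dec <⁺-dec _<?_ [ k ] (δ u v))
    where open DecMembership _≟_ using (_∈?_)

  independenceNumber : ∀ k → ∃ (IsIndependenceNumber k)
  independenceNumber k = greatest
    (anyList? anyVertex? (λ S → DecUnique.unique? _≟_ S ×-dec independent? k S))
    ([] , refl , [] , λ ())
    (order G)
    (λ { (S , refl , unique , _) →
      Fin.injective⇒≤ λ e → listLookup-injective unique _ _ (enum-injective e) })

α : ℕ → Graph → ℕ
α k G = proj₁ (independenceNumber G k)

{-# OPTIONS --safe #-}
module Submission where

-- δ(u,v) > k means that no walk of length at most k joins u and v, since a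
-- shortest walk is a path.  Walks in the product project to walks in each factor
-- that are no longer, so the product of two independent sets is independent.
-- Walks in one factor lift to each of its copies in the product, so an
-- independent set of the product meets every copy in an independent set.

open import Data.Fin.Base using (Fin)
import Data.Fin.Properties as Fin
open import Data.List.Base using (List; []; _∷_; _++_; length; map; filter; allFin; cartesianProduct)
open import Data.List.Membership.Propositional using (_∈_)
open import Data.List.Membership.Propositional.Properties
  using (∈-allFin; ∈-filter⁻; ∈-map⁻; ∈-cartesianProduct⁻)
open import Data.List.Properties using (length-++; length-map; length-tabulate; partition-defn)
open import Data.List.Relation.Binary.Permutation.Setoid.Properties using (partition-↭; xs↭ys⇒|xs|≡|ys|)
open import Data.List.Relation.Binary.Sublist.Propositional.Properties
  using (filter-⊆; length-mono-≤) renaming (filter⁺ to ⊆-filter⁺)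
open import Data.List.Relation.Unary.All as All using (All; []; _∷_)
open import Data.List.Relation.Unary.All.Properties using (all-filter; map⁺)
  renaming (filter⁺ to All-filter⁺)
open import Data.List.Relation.Unary.AllPairs using ([]; _∷_)
open import Data.List.Relation.Unary.Any using (here; there)
open import Data.List.Relation.Unary.Unique.Propositional using (Unique)
open import Data.List.Relation.Unary.Unique.Propositional.Properties
  using (cartesianProduct⁺) renaming (filter⁺ to Unique-filter⁺)
open import Data.Nat.Base using (ℕ; suc; _+_; _*_; _⊓_; _≤_; _≥_; _<_; z≤n; s≤s)
open import Data.Nat.Properties
  using (≤-refl; ≤-reflexive; ≤-trans; m≤n⇒m≤1+n; n≤1+n; +-mono-≤; *-comm; ⊓-glb; ≰⇒>; <⇒≱;
         module ≤-Reasoning)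
open import Data.Product.Base using (∃-syntax; _×_; _,_; proj₁; proj₂)
open import Data.Sum.Base using (_⊎_; inj₁; inj₂)
open import Data.Vec.Base using (Vec; []; _∷_; head; last)
open import Data.Vec.Relation.Unary.All as VecAll using ([]; _∷_)
open import Data.Vec.Relation.Unary.AllPairs using ([]; _∷_)
open import Data.Vec.Relation.Unary.Linked using (Linked; [-]; _∷_)
import Data.Vec.Relation.Unary.Unique.Propositional as VecUnique
open import Function.Base using (_∘_; id)
open import Function.Bundles using (_⇔_; mk⇔; Equivalence; Inverse; Injection)
open import Function.Properties.Inverse using (↔⇒↣)
open import Level using (0ℓ)
open import Relation.Binary.Construct.Add.Supremum.Strict _<_ using (_<⁺_; [_]; [_]<⊤⁺)
open import Relation.Binary.PropositionalEquality
  using (_≡_; _≢_; refl; sym; trans; cong; cong₂; setoid)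
open import Relation.Nullary.Construct.Add.Supremum using ([_]; ⊤⁺)
open import Relation.Nullary.Decidable using (yes; no)
open import Relation.Nullary.Negation using (¬_; contradiction)
open import Relation.Unary using (Pred; Decidable)
open import Relation.Unary.Properties using (∁?)
open import Defs
  using (Graph; _□_; α; Path; IsDistance; δ; distance; IsIndependenceNumber; independenceNumber)
open Graph using (Vertex; order)

module _ {A B : Set} where

  length-cartesianProduct : ∀ (xs : List A) (ys : List B) →
                            length (cartesianProduct xs ys) ≡ length xs * length ys
  length-cartesianProduct []       ys = refl
  length-cartesianProduct (x ∷ xs) ys = trans
    (length-++ (map (x ,_) ys))
    (cong₂ _+_ (length-map (x ,_) ys) (length-cartesianProduct xs ys))

  -- Injectivity is asked only where `P` holds: the maps used below are injective on one colour
  -- class but not globally.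
  Unique-map⁺ : {P : Pred A 0ℓ} (f : A → B) → (∀ {x y} → P x → P y → f x ≡ f y → x ≡ y) →
                ∀ {xs} → All P xs → Unique xs → Unique (map f xs)
  Unique-map⁺ f inj []         []         = []
  Unique-map⁺ f inj (px ∷ pxs) (x∉ ∷ xs!) =
    map⁺ (All.zipWith (λ (py , x≢y) → x≢y ∘ inj px py) (pxs , x∉)) ∷ Unique-map⁺ f inj pxs xs!

length-filter-∁ : {A : Set} {P : Pred A 0ℓ} (P? : Decidable P) (xs : List A) →
                  length xs ≡ length (filter P? xs) + length (filter (∁? P?) xs)
length-filter-∁ {A} P? xs = trans
  (xs↭ys⇒|xs|≡|ys| (setoid A) (partition-↭ (setoid A) P? xs))
  (trans (cong (λ (ys , zs) → length (ys ++ zs)) (partition-defn P? xs))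
         (length-++ (filter P? xs)))

module _ {A : Set} {n : ℕ} (f : A → Fin n) where

  fibre : Fin n → List A → List A
  fibre i = filter (λ x → f x Fin.≟ i)

  -- Induction on the list of colours: splitting off the fibre over the first colour `i` costs at
  -- most `b`, and what remains has its colours in the tail. Letting `is` be any list that covers
  -- the colours is what allows the induction to discard one.
  length≤fibres : ∀ {b} is {xs} → All (λ x → f x ∈ is) xs → (∀ i → length (fibre i xs) ≤ b) →
                  length xs ≤ length is * b
  length≤fibres []       []       _     = z≤n
  length≤fibres {b} (i ∷ is) {xs} f∈is bound = begin
    length xs                          ≡⟨ length-filter-∁ i? xs ⟩
    length (fibre i xs) + length rest  ≤⟨ +-mono-≤ (bound i) (length≤fibres is rest∈is rest-bound) ⟩
    b + length is * b                  ∎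
    where
    open ≤-Reasoning
    i? : Decidable (λ x → f x ≡ i)
    i? x = f x Fin.≟ i
    rest = filter (∁? i?) xs
    tail-∈ : ∀ {j} → j ≢ i → j ∈ i ∷ is → j ∈ is
    tail-∈ j≢i (here j≡i)   = contradiction j≡i j≢i
    tail-∈ _   (there j∈is) = j∈is
    rest∈is : All (λ x → f x ∈ is) rest
    rest∈is = All.zipWith (λ (≢i , ∈is) → tail-∈ ≢i ∈is)
      (all-filter (∁? i?) xs , All-filter⁺ (∁? i?) f∈is)
    -- Filtering preserves sublists, so each fibre of `rest` is a sublist of the corresponding fibre
    -- of `xs` and inherits its bound.
    rest-bound : ∀ j → length (fibre j rest) ≤ b
    rest-bound j = ≤-trans
      (length-mono-≤ (⊆-filter⁺ (λ x → f x Fin.≟ j) (λ x → f x Fin.≟ j) (λ { refl → id }) (filter-⊆ (∁? i?) xs)))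
      (bound j)

-- The index bounds the length of the walk from above.
data Walk (G : Graph) : Vertex G → Vertex G → ℕ → Set where
  stop : ∀ {u m} → Walk G u u m
  step : ∀ {u v w m} → Graph._~_ G u w → Walk G w v m → Walk G u v (suc m)

weaken : ∀ {G u v m n} → m ≤ n → Walk G u v m → Walk G u v n
weaken m≤n       stop       = stop
weaken (s≤s m≤n) (step e w) = step e (weaken m≤n w)

module _ (G H : Graph) (f : Vertex G → Vertex H) where
  private
    module G = Graph G
    module H = Graph H

  -- The map may collapse edges, as the projections of a product do to edges of the other factor. A
  -- collapsed edge is dropped from the walk, and the slack in the index absorbs the loss.
  mapWalk : (∀ {u v} → u G.~ v → f u ≡ f v ⊎ f u H.~ f v) →
            ∀ {u v m} → Walk G u v m → Walk H (f u) (f v) m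
  mapWalk hom stop = stop
  mapWalk hom {v = v} {m = suc m} (step e w) with hom e
  ... | inj₁ fu≡fw rewrite fu≡fw = weaken (n≤1+n m) (mapWalk hom w)
  ... | inj₂ fu~fw               = step fu~fw (mapWalk hom w)

module _ (G : Graph) where
  open Graph G using (_~_; _≟_)

  linked⇒walk : ∀ {m} (xs : Vec (Vertex G) (suc m)) → Linked _~_ xs → Walk G (head xs) (last xs) m
  linked⇒walk (x ∷ [])     [-]     = stop
  linked⇒walk (x ∷ y ∷ xs) (e ∷ l) = step e (linked⇒walk (y ∷ xs) l)

  path⇒walk : ∀ {u v m} → Path G u v m → Walk G u v m
  path⇒walk record { vertices = xs ; starts = refl ; ends = refl ; linked = l } = linked⇒walk xs l

  -- This removes cycles. If `u` lies on the path, the part from `u` onwards is again a path and no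
  -- longer; if not, `u` can be put in front without repeating a vertex.
  path-from-or-avoids : ∀ u {m} (xs : Vec (Vertex G) (suc m)) → Linked _~_ xs → VecUnique.Unique xs →
    (∃[ n ] n ≤ m × Path G u (last xs) n) ⊎ VecAll.All (u ≢_) xs
  path-from-or-avoids u {m} (x ∷ xs) l d with u ≟ x
  path-from-or-avoids u {m} (x ∷ xs) l d | yes refl = inj₁ (m , ≤-refl ,
    record { vertices = x ∷ xs ; starts = refl ; ends = refl ; linked = l ; unique = d })
  path-from-or-avoids u (x ∷ []) l d | no u≢x = inj₂ (u≢x ∷ [])
  path-from-or-avoids u (x ∷ y ∷ xs) (_ ∷ l) (_ ∷ d) | no u≢x with path-from-or-avoids u (y ∷ xs) l d
  ... | inj₁ (n , n≤m , p) = inj₁ (n , m≤n⇒m≤1+n n≤m , p)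
  ... | inj₂ u∉            = inj₂ (u≢x ∷ u∉)

  walk⇒path : ∀ {u v m} → Walk G u v m → ∃[ n ] n ≤ m × Path G u v n
  walk⇒path {u} stop = 0 , z≤n ,
    record { vertices = u ∷ [] ; starts = refl ; ends = refl ; linked = [-] ; unique = [] ∷ [] }
  walk⇒path {u} (step e w) with walk⇒path w
  ... | n , n≤m , record { vertices = xs ; starts = refl ; ends = refl ; linked = l ; unique = d }
    with path-from-or-avoids u xs l d
  ...   | inj₁ (n′ , n′≤n , p) = n′ , m≤n⇒m≤1+n (≤-trans n′≤n n≤m) , p
  ...   | inj₂ u∉              = suc n , s≤s n≤m ,
    record { vertices = u ∷ xs ; starts = refl ; ends = refl ; linked = e ∷ l ; unique = u∉ ∷ d }

  -- A walk of length at most `k` shortens to a path that contradicts the minimality of `d`, or the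
  -- absence of paths when `d` is infinite; conversely a shortest path of length at most `k` is such
  -- a walk. Keeping `d` arbitrary lets the two cases be split without unfolding the search behind
  -- `δ`.
  IsDistance⇒<⇔¬walk : ∀ {u v k} d → IsDistance G u v d → [ k ] <⁺ d ⇔ (¬ Walk G u v k)
  IsDistance⇒<⇔¬walk {u} {v} {k} d isDist = mk⇔ (to d isDist) (from d isDist)
    where
    to : ∀ d → IsDistance G u v d → [ k ] <⁺ d → ¬ Walk G u v k
    to d isDist k<d w with walk⇒path w
    to [ d ] (_ , min) [ k<d ]  w | n , n≤k , p = <⇒≱ k<d (≤-trans (min p) n≤k)
    to ⊤⁺    none      [ _ ]<⊤⁺ w | n , _   , p = none p
    from : ∀ d → IsDistance G u v d → ¬ Walk G u v k → [ k ] <⁺ d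
    from [ d ] (p , _) ¬w = [ ≰⇒> (λ d≤k → ¬w (weaken d≤k (path⇒walk p))) ]
    from ⊤⁺    _       _  = [ _ ]<⊤⁺

  <δ⇔¬walk : ∀ {u v k} → [ k ] <⁺ δ G u v ⇔ (¬ Walk G u v k)
  <δ⇔¬walk {u} {v} = IsDistance⇒<⇔¬walk (δ G u v) (proj₂ (distance G u v))

  WalkIndependent : ℕ → List (Vertex G) → Set
  WalkIndependent k S = ∀ {u v} → u ∈ S → v ∈ S → u ≢ v → ¬ Walk G u v k

  -- Together with `attained`, this restates maximality and attainment in terms of walks, so that
  -- the arguments below never mention `δ`.
  length≤ : ∀ {k a S} → IsIndependenceNumber G k a → Unique S → WalkIndependent k S → length S ≤ a
  length≤ (_ , max) S! ind =
    max (_ , refl , S! , λ u∈ v∈ u≢v → Equivalence.from <δ⇔¬walk (ind u∈ v∈ u≢v))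

  attained : ∀ {k a} → IsIndependenceNumber G k a →
             ∃[ S ] length S ≡ a × Unique S × WalkIndependent k S
  attained ((S , |S|≡a , S! , ind) , _) =
    S , |S|≡a , S! , λ u∈ v∈ u≢v → Equivalence.to <δ⇔¬walk (ind u∈ v∈ u≢v)

-- By lift, distances in H within a colour class are at most those between the
-- images under g, so g maps the part of an independent set of H lying in a
-- single class injectively onto an independent set of G.
module _ (G H : Graph) (g : Vertex H → Vertex G) {n : ℕ} (colour : Vertex H → Fin n)
  (jointly-injective : ∀ {x y} → colour x ≡ colour y → g x ≡ g y → x ≡ y)
  (lift : ∀ {x y m} → colour x ≡ colour y → Walk G (g x) (g y) m → Walk H x y m)
  where

  number≤number*colours : ∀ {k a b} → IsIndependenceNumber G k a → IsIndependenceNumber H k b →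
                          b ≤ a * n
  number≤number*colours {k} {a} {b} isA isB with attained H isB
  ... | S , refl , S! , ind = begin
    length S               ≤⟨ length≤fibres colour (allFin n) (All.universal (λ x → ∈-allFin (colour x)) S) class≤a ⟩
    length (allFin n) * a  ≡⟨ cong (_* a) (length-tabulate {n = n} id) ⟩
    n * a                  ≡⟨ *-comm n a ⟩
    a * n                  ∎
    where
    open ≤-Reasoning
    class≤a : ∀ i → length (fibre colour i S) ≤ a
    class≤a i = ≤-trans (≤-reflexive (sym (length-map g (fibre colour i S)))) (length≤ G isA class! class-ind)
      where
      i? : Decidable (λ x → colour x ≡ i)
      i? x = colour x Fin.≟ i
      class! : Unique (map g (fibre colour i S))
      -- Members of one fibre share the colour `i`, so joint injectivity makes `g` injective there.
      class! = Unique-map⁺ g (λ p q → jointly-injective (trans p (sym q)))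
        (all-filter i? S) (Unique-filter⁺ i? S!)
      class-ind : WalkIndependent G k (map g (fibre colour i S))
      -- Distinct images come from distinct members of `S`, and a walk between the images would lift
      -- to one between these members, against the independence of `S`.
      class-ind u∈ v∈ u≢v w with ∈-map⁻ g u∈ | ∈-map⁻ g v∈
      ... | x , x∈ , refl | y , y∈ , refl with ∈-filter⁻ i? {xs = S} x∈ | ∈-filter⁻ i? {xs = S} y∈
      ... | x∈S , cx | y∈S , cy = ind x∈S y∈S (u≢v ∘ cong g) (lift (trans cx (sym cy)) w)

module _ (G₁ G₂ : Graph) where
  private
    module G₁ = Graph G₁
    module G₂ = Graph G₂

  proj₁-walk : ∀ {u v m} → Walk (G₁ □ G₂) u v m → Walk G₁ (proj₁ u) (proj₁ v) m
  proj₁-walk = mapWalk (G₁ □ G₂) G₁ proj₁ λ { (inj₁ (e , _)) → inj₁ e ; (inj₂ (_ , a)) → inj₂ a }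

  proj₂-walk : ∀ {u v m} → Walk (G₁ □ G₂) u v m → Walk G₂ (proj₂ u) (proj₂ v) m
  proj₂-walk = mapWalk (G₁ □ G₂) G₂ proj₂ λ { (inj₁ (_ , a)) → inj₂ a ; (inj₂ (e , _)) → inj₁ e }

  -- Distinct pairs differ in some coordinate, and projecting a short walk to that factor
  -- contradicts independence there.
  product≤number-□ : ∀ {k a₁ a₂ a} → IsIndependenceNumber G₁ k a₁ → IsIndependenceNumber G₂ k a₂ →
                     IsIndependenceNumber (G₁ □ G₂) k a → a₁ * a₂ ≤ a
  product≤number-□ {k} {a = a} is₁ is₂ is with attained G₁ is₁ | attained G₂ is₂
  ... | S₁ , refl , S₁! , ind₁ | S₂ , refl , S₂! , ind₂ = begin
    length S₁ * length S₂            ≡⟨ length-cartesianProduct S₁ S₂ ⟨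
    length (cartesianProduct S₁ S₂)  ≤⟨ length≤ (G₁ □ G₂) is (cartesianProduct⁺ S₁! S₂!) ind ⟩
    a                                ∎
    where
    open ≤-Reasoning
    ind : WalkIndependent (G₁ □ G₂) k (cartesianProduct S₁ S₂)
    ind {u₁ , u₂} {v₁ , v₂} u∈ v∈ u≢v w
      with ∈-cartesianProduct⁻ S₁ S₂ u∈ | ∈-cartesianProduct⁻ S₁ S₂ v∈ | u₁ G₁.≟ v₁
    ... | u₁∈ , _ | v₁∈ , _ | no u₁≢v₁ = ind₁ u₁∈ v₁∈ u₁≢v₁ (proj₁-walk w)
    ... | _ , u₂∈ | _ , v₂∈ | yes refl = ind₂ u₂∈ v₂∈ (u≢v ∘ cong (u₁ ,_)) (proj₂-walk w)

  -- Colouring a vertex by the index of its second coordinate makes the colour classes the copies of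
  -- `G₁`, one for each vertex of `G₂`.
  number-□≤₁ : ∀ {k a₁ a} → IsIndependenceNumber G₁ k a₁ → IsIndependenceNumber (G₁ □ G₂) k a →
               a ≤ a₁ * order G₂
  number-□≤₁ = number≤number*colours G₁ (G₁ □ G₂) proj₁ (Inverse.to G₂.enum ∘ proj₂)
    (λ c e → cong₂ _,_ e (enum-injective c))
    (λ c w → lift (enum-injective c) w)
    where
    enum-injective = Injection.injective (↔⇒↣ G₂.enum)
    lift : ∀ {u v a b m} → a ≡ b → Walk G₁ u v m → Walk (G₁ □ G₂) (u , a) (v , b) m
    -- The outer `inj₂` says that the edge is kept rather than collapsed; the inner one, that it
    -- moves in the first factor.
    lift {a = a} refl = mapWalk G₁ (G₁ □ G₂) (_, a) λ e → inj₂ (inj₂ (refl , e))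

  number-□≤₂ : ∀ {k a₂ a} → IsIndependenceNumber G₂ k a₂ → IsIndependenceNumber (G₁ □ G₂) k a →
               a ≤ a₂ * order G₁
  number-□≤₂ = number≤number*colours G₂ (G₁ □ G₂) proj₂ (Inverse.to G₁.enum ∘ proj₁)
    (λ c e → cong₂ _,_ (enum-injective c) e)
    (λ c w → lift (enum-injective c) w)
    where
    enum-injective = Injection.injective (↔⇒↣ G₁.enum)
    lift : ∀ {u v a b m} → a ≡ b → Walk G₂ u v m → Walk (G₁ □ G₂) (a , u) (b , v) m
    lift {a = a} refl = mapWalk G₂ (G₁ □ G₂) (a ,_) λ e → inj₂ (inj₁ (refl , e))

theorem3p3 : (k : ℕ) → k ≥ 1 → (G₁ G₂ : Graph) →
    (α k (G₁ □ G₂) ≥ α k G₁ * α k G₂) ×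
    (α k (G₁ □ G₂) ≤ (α k G₁ * order G₂) ⊓ (α k G₂ * order G₁))
theorem3p3 k _ G₁ G₂ =
  product≤number-□ G₁ G₂ (isα G₁) (isα G₂) (isα (G₁ □ G₂)) ,
  ⊓-glb (number-□≤₁ G₁ G₂ (isα G₁) (isα (G₁ □ G₂))) (number-□≤₂ G₁ G₂ (isα G₂) (isα (G₁ □ G₂)))
  where
  isα : ∀ G → IsIndependenceNumber G k (α k G)
  isα G = proj₂ (independenceNumber G k)
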